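{- Let $k\ge 3$ and $2\le m\le k-1$ be integers, and put $t=k-m+1$. Then for every integer $w\ge t+1$, $$\psi(w,k,m)\ \ge\ (k-1)\,\psi(w-1,k,m)+\left\lfloor\frac{k-1}{t}\right\rfloor f(w-t,k).$$
   Context: All set families are finite families of distinct sets. A family is $w$-uniform if all its members have exactly $w$ elements (the ground set is an arbitrary finite set, not fixed). A $k$-sunflower is a collection of $k$ distinct sets $A_1,\dots,A_k$ for which there is a set $C$ (the core, possibly empty) with $A_i\cap A_j=C$ for all $i\ne j$. The matching number $\nu(\mathcal F)$ is the largest number of pairwise disjoint members of $\mathcal F$. For $w\ge1$, $k\ge2$, $f(w,k)$ denotes the maximum size of a $w$-uniform family containing no $k$-sunflower (finite by the Erdős–Rado sunflower lemma). For $m\ge2$, $\psi(w,k,m)$ denotes the maximum size of a $w$-uniform family $\mathcal F$ containing no $k$-sunflower and satisfying $\nu(\mathcal F)\le m-1$. -}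

module Defs where

open import Data.Bool.Base using (_∧_)
import Data.Bool.Properties as Bool
open import Data.Fin.Base as Fin using (Fin; zero; suc)
import Data.Fin.Properties as Fin
open import Data.Fin.Subset as Subset using (Subset; inside; outside; _∩_; ∣_∣; ⊥)
import Data.Fin.Subset.Properties as Subset
open import Data.List.Base
  using (List; []; _∷_; length; map; _++_; concat; concatMap; filter; lookup; take; allFin)
import Data.List.Properties as List
open import Data.List.Membership.Propositional using (_∈_; find)
import Data.List.Membership.DecPropositional as DecMembership
import Data.List.Membership.Propositional.Properties as Mem
open import Data.List.Relation.Binary.Subset.Propositional using (_⊆_)
open import Data.List.Relation.Unary.All as All using (All; []; _∷_)
import Data.List.Relation.Unary.All.Properties as All
open import Data.List.Relation.Unary.AllPairs as AllPairs using (AllPairs; []; _∷_)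
import Data.List.Relation.Unary.AllPairs.Properties as AllPairs
open import Data.List.Relation.Unary.Any as Any using (here; there)
import Data.List.Relation.Unary.Any.Properties as Any
open import Data.List.Relation.Unary.Unique.Propositional using (Unique)
import Data.List.Relation.Unary.Unique.Propositional.Properties as Unique
open import Data.Nat.Base using (ℕ; zero; suc; _+_; _*_; _∸_; _≤_; _<_; z≤n; s≤s)
import Data.Nat.Properties as ℕ
open import Data.Product.Base using (∃; _×_; _,_; proj₁; proj₂)
open import Data.Sum.Base using (_⊎_; inj₁; inj₂)
open import Data.Vec.Base as Vec using ([]; _∷_; here; there; _[_]≔_)
import Data.Vec.Properties as Vec
open import Function.Base using (_∘_; id)
open import Relation.Binary.Definitions using (DecidableEquality)
open import Relation.Binary.PropositionalEquality
open import Relation.Nullary using (¬_; Dec; yes; no; contradiction)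
open import Relation.Nullary.Decidable using (map′; _×-dec_; ¬?)
open import Relation.Unary using (Decidable)

private
  variable
    n : ℕ

-- A finite family of sets is a duplicate-free list of subsets of some
-- Fin n; its size is the length of the list.

Uniform : ℕ → List (Subset n) → Set
Uniform w = All (λ X → ∣ X ∣ ≡ w)

-- Since ∩ is commutative, AllPairs (which ranges over pairs in list
-- order) gives the condition for all i ≠ j.

IsSunflower : List (Subset n) → Set
IsSunflower A = Unique A × ∃ λ C → AllPairs (λ X Y → X ∩ Y ≡ C) A

IsMatching : List (Subset n) → Set
IsMatching A = Unique A × AllPairs (λ X Y → X ∩ Y ≡ ⊥) A

ContainsSunflower : ℕ → List (Subset n) → Set
ContainsSunflower k F = ∃ λ A → length A ≡ k × A ⊆ F × IsSunflower A

ContainsMatching : List (Subset n) → ℕ → Set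
ContainsMatching F r = ∃ λ A → length A ≡ r × A ⊆ F × IsMatching A

SunflowerFree : ℕ → ℕ → List (Subset n) → Set
SunflowerFree w k F = Unique F × Uniform w F × ¬ ContainsSunflower k F

IsMaximum : (ℕ → Set) → ℕ → Set
IsMaximum P v = P v × (∀ u → P u → u ≤ v)

maximum : {P : ℕ → Set} → Decidable P → P 0 →
          ∀ b → (∀ u → P u → u ≤ b) → ∃ (IsMaximum P)
maximum P? p₀ zero    ub = 0 , p₀ , ub
maximum P? p₀ (suc b) ub with P? (suc b)
... | yes p = suc b , p , ub
... | no ¬p = maximum P? p₀ b λ u pu → ℕ.≤-pred (ℕ.≤∧≢⇒< (ub u pu) λ { refl → ¬p pu })

_≟_ : DecidableEquality (Subset n)
_≟_ = Vec.≡-dec Bool._≟_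

anyOfLength? : ∀ r {P : List (Subset n) → Set} → Decidable P →
               Dec (∃ λ A → length A ≡ r × P A)
anyOfLength? zero    P? = map′ (λ p → [] , refl , p) (λ { ([] , refl , p) → p }) (P? [])
anyOfLength? (suc r) P? =
  map′ (λ { (X , A , refl , p) → X ∷ A , refl , p })
       (λ { (X ∷ A , refl , p) → X , A , refl , p })
       (Subset.anySubset? λ X → anyOfLength? r λ A → P? (X ∷ A))

_⊆?_ : (A F : List (Subset n)) → Dec (A ⊆ F)
A ⊆? F = map′ (λ a {_} → All.lookup a) (λ s → All.tabulate s) (All.all? (_∈? F) A)
  where open DecMembership _≟_ using (_∈?_)

unique? : Decidable (Unique {A = Subset n})
unique? = AllPairs.allPairs? λ X Y → ¬? (X ≟ Y)

containsSunflower? : ∀ k → Decidable (ContainsSunflower {n} k)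
containsSunflower? k F = anyOfLength? k λ A →
  (A ⊆? F) ×-dec unique? A ×-dec
  Subset.anySubset? λ C → AllPairs.allPairs? (λ X Y → (X ∩ Y) ≟ C) A

containsMatching? : (F : List (Subset n)) → Decidable (ContainsMatching F)
containsMatching? F r = anyOfLength? r λ A →
  (A ⊆? F) ×-dec unique? A ×-dec AllPairs.allPairs? (λ X Y → (X ∩ Y) ≟ ⊥) A

sunflowerFree? : ∀ w k → Decidable (SunflowerFree {n} w k)
sunflowerFree? w k F =
  unique? F ×-dec All.all? (λ X → ∣ X ∣ ℕ.≟ w) F ×-dec ¬? (containsSunflower? k F)

module _ {A : Set} where

  lookup-injective : {xs : List A} → Unique xs →
                     ∀ {i j} → lookup xs i ≡ lookup xs j → i ≡ j
  lookup-injective (_ ∷ _)  {zero}  {zero}  _  = refl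
  lookup-injective (x∉ ∷ _) {zero}  {suc j} eq = contradiction eq (All.lookup x∉ (Mem.∈-lookup j))
  lookup-injective (x∉ ∷ _) {suc i} {zero}  eq = contradiction (sym eq) (All.lookup x∉ (Mem.∈-lookup i))
  lookup-injective (_ ∷ u)  {suc i} {suc j} eq = cong suc (lookup-injective u eq)

  unique-⊆⇒length≤ : {xs ys : List A} → Unique xs → xs ⊆ ys → length xs ≤ length ys
  unique-⊆⇒length≤ {xs} {ys} u s = Fin.injective⇒≤ {f = pos} λ {i} {j} eq →
    lookup-injective u (trans (at i) (trans (cong (lookup ys) eq) (sym (at j))))
    where
    pos : Fin (length xs) → Fin (length ys)
    pos i = Any.index (s (Mem.∈-lookup i))
    at : ∀ i → lookup xs i ≡ lookup ys (pos i)
    at i = Any.lookup-index (s (Mem.∈-lookup i))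

  take-⊆ : ∀ k (xs : List A) → take k xs ⊆ xs
  take-⊆ (suc k) (x ∷ xs) (here eq) = here eq
  take-⊆ (suc k) (x ∷ xs) (there p) = there (take-⊆ k xs p)

unique-map : {A B : Set} (f : A → B) (g : B → A) (xs : List A) →
             (∀ {x} → x ∈ xs → g (f x) ≡ x) → Unique xs → Unique (map f xs)
unique-map f g []       inv []       = []
unique-map f g (x ∷ xs) inv (x∉ ∷ u) =
  All.map⁺ (All.tabulate λ {y} y∈ eq → All.lookup x∉ y∈
    (trans (sym (inv (here refl))) (trans (cong g eq) (inv (there y∈)))))
  ∷ unique-map f g xs (inv ∘ there) u

matching-bound : (F : List (Subset n)) → ∀ r → ContainsMatching F r → r ≤ length F
matching-bound F r (A , refl , A⊆F , u , _) = unique-⊆⇒length≤ u A⊆F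

abstract
  ν-exists : (F : List (Subset n)) → ∃ (IsMaximum (ContainsMatching F))
  ν-exists F = maximum (containsMatching? F) ([] , refl , (λ ()) , [] , [])
                       (length F) (matching-bound F)

ν : List (Subset n) → ℕ
ν F = proj₁ (ν-exists F)

ν-maximum : (F : List (Subset n)) → IsMaximum (ContainsMatching F) (ν F)
ν-maximum F = proj₂ (ν-exists F)

module Pull {m n} (φ : Subset m → Subset n) (γ c : Subset n → Subset m)
            (F : List (Subset m))
            (γφ : ∀ {X} → X ∈ F → γ (φ X) ≡ X)
            (γ-∩ : ∀ X Y → γ X ∩ γ Y ≡ c (X ∩ Y)) where

  pull : ∀ {A} → A ⊆ map φ F → Unique A → map γ A ⊆ F × Unique (map γ A)
  pull {A} A⊆ u = back , unique-map γ φ A φγ u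
    where
    preimage : ∀ {Y} → Y ∈ A → ∃ λ X → X ∈ F × Y ≡ φ X
    preimage = Mem.∈-map⁻ φ ∘ A⊆
    back : map γ A ⊆ F
    back p with Mem.∈-map⁻ γ p
    ... | Y , Y∈ , refl with preimage Y∈
    ... | X , X∈ , refl = subst (_∈ F) (sym (γφ X∈)) X∈
    φγ : ∀ {Y} → Y ∈ A → φ (γ Y) ≡ Y
    φγ Y∈ with preimage Y∈
    ... | X , X∈ , refl = cong φ (γφ X∈)

  pull-∩ : ∀ {A C} → AllPairs (λ X Y → X ∩ Y ≡ C) A →
           AllPairs (λ X Y → X ∩ Y ≡ c C) (map γ A)
  pull-∩ ap = AllPairs.map⁺ (AllPairs.map (λ {X} {Y} eq → trans (γ-∩ X Y) (cong c eq)) ap)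

  sunflower : ∀ {k} → ContainsSunflower k (map φ F) → ContainsSunflower k F
  sunflower (A , refl , A⊆ , u , C , ap) with pull A⊆ u
  ... | s , u′ = map γ A , List.length-map γ A , s , u′ , c C , pull-∩ ap

  matching : c ⊥ ≡ ⊥ → ∀ {r} → ContainsMatching (map φ F) r → ContainsMatching F r
  matching c⊥ (A , refl , A⊆ , u , ap) with pull A⊆ u
  ... | s , u′ = map γ A , List.length-map γ A , s , u′ ,
                 AllPairs.map (λ eq → trans eq c⊥) (pull-∩ ap)

elements : Subset n → List (Fin n)
elements []            = []
elements (inside  ∷ X) = zero ∷ map suc (elements X)
elements (outside ∷ X) = map suc (elements X)

length-elements : (X : Subset n) → length (elements X) ≡ ∣ X ∣
length-elements []            = refl
length-elements (inside  ∷ X) = cong suc (trans (List.length-map Fin.suc (elements X)) (length-elements X))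
length-elements (outside ∷ X) = trans (List.length-map Fin.suc (elements X)) (length-elements X)

∈-elements : ∀ {x} {X : Subset n} → x Subset.∈ X → x ∈ elements X
∈-elements {X = _       ∷ _} here      = here refl
∈-elements {X = inside  ∷ _} (there p) = there (Mem.∈-map⁺ suc (∈-elements p))
∈-elements {X = outside ∷ _} (there p) = Mem.∈-map⁺ suc (∈-elements p)

union : List (Subset n) → List (Fin n)
union = concatMap elements

length-union : ∀ {w} (F : List (Subset n)) → Uniform w F → length (union F) ≡ length F * w
length-union []      []         = refl
length-union (X ∷ F) (refl ∷ u) = trans (List.length-++ (elements X))
  (cong₂ _+_ (length-elements X) (length-union F u))

∈-union : ∀ {x X} {F : List (Subset n)} → X ∈ F → x Subset.∈ X → x ∈ union F
∈-union (here refl) x∈ = Mem.∈-++⁺ˡ (∈-elements x∈)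
∈-union {F = Y ∷ _} (there X∈) x∈ = Mem.∈-++⁺ʳ (elements Y) (∈-union X∈ x∈)

-- Forbidding sunflowers with suc p petals gives the bound w! * p ^ w.

erdősRadoBound : ℕ → ℕ → ℕ
erdősRadoBound zero    p = 1
erdősRadoBound (suc w) p = (p * suc w) * erdősRadoBound w p

module _ {A : Set} {P : A → Set} (P? : Decidable P) where

  length-split : ∀ xs → length xs ≡ length (filter P? xs) + length (filter (¬? ∘ P?) xs)
  length-split []       = refl
  length-split (x ∷ xs) with P? x
  ... | yes _ = cong suc (length-split xs)
  ... | no  _ = trans (cong suc (length-split xs)) (sym (ℕ.+-suc _ _))

filter-free : ∀ {w k} {P : Subset n → Set} (P? : Decidable P) {F} →
              SunflowerFree w k F → SunflowerFree w k (filter P? F)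
filter-free P? (u , un , ¬s) =
  Unique.filter⁺ P? u , All.filter⁺ P? un ,
  λ { (A , l , A⊆ , sf) → ¬s (A , l , (λ x∈ → proj₁ (Mem.∈-filter⁻ P? (A⊆ x∈))) , sf) }

cover : ∀ {w k B} →
        (∀ x {G : List (Subset n)} → SunflowerFree w k G → All (x Subset.∈_) G → length G ≤ B) →
        ∀ L {F} → SunflowerFree w k F → (∀ {X} → X ∈ F → ∃ λ x → x ∈ L × x Subset.∈ X) →
        length F ≤ length L * B
cover link []      {[]}    free hit = z≤n
cover link []      {X ∷ F} free hit with hit (here refl)
... | _ , () , _
cover {B = B} link (y ∷ L) {F} free hit = begin
  length F                                                   ≡⟨ length-split P? F ⟩
  length (filter P? F) + length (filter (¬? ∘ P?) F)         ≤⟨ ℕ.+-mono-≤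
      (link y (filter-free P? free) (All.all-filter P? F))
      (cover link L (filter-free (¬? ∘ P?) free) hit′) ⟩
  B + length L * B                                           ∎
  where
  open ℕ.≤-Reasoning
  P? = λ X → y Subset.∈? X
  hit′ : ∀ {X} → X ∈ filter (¬? ∘ P?) F → ∃ λ x → x ∈ L × x Subset.∈ X
  hit′ X∈ with Mem.∈-filter⁻ (¬? ∘ P?) X∈
  ... | X∈F , y∉X with hit X∈F
  ... | x , here refl , x∈X = contradiction x∈X y∉X
  ... | x , there x∈L , x∈X = x , x∈L , x∈X

∩-[]≔ : ∀ {a} (X Y : Subset n) x → (X [ x ]≔ a) ∩ (Y [ x ]≔ a) ≡ (X ∩ Y) [ x ]≔ a
∩-[]≔ (b ∷ X) (d ∷ Y) zero    = cong (_∷ (X ∩ Y)) (Bool.∧-idem _)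
∩-[]≔ (b ∷ X) (d ∷ Y) (suc x) = cong ((b ∧ d) ∷_) (∩-[]≔ X Y x)

∣-∣-remove : ∀ {X : Subset n} {x} → x Subset.∈ X → suc ∣ X [ x ]≔ outside ∣ ≡ ∣ X ∣
∣-∣-remove {X = inside  ∷ _} here      = refl
∣-∣-remove {X = inside  ∷ _} (there p) = cong suc (∣-∣-remove p)
∣-∣-remove {X = outside ∷ _} (there p) = ∣-∣-remove p

remove-add : ∀ {X : Subset n} {x} → x Subset.∈ X → (X [ x ]≔ outside) [ x ]≔ inside ≡ X
remove-add {X = X} {x} x∈ =
  trans (Vec.[]≔-idempotent X x)
        (trans (cong (X [ x ]≔_) (sym (Vec.[]=⇒lookup x∈))) (Vec.[]≔-lookup X x))

link-free : ∀ {w k} x {G : List (Subset n)} → SunflowerFree (suc w) k G →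
            All (x Subset.∈_) G → SunflowerFree w k (map (_[ x ]≔ outside) G)
link-free x {G} (u , un , ¬s) x∈G =
  unique-map (_[ x ]≔ outside) (_[ x ]≔ inside) G (λ X∈ → remove-add (All.lookup x∈G X∈)) u ,
  All.map⁺ (All.zipWith (λ (c , x∈) → ℕ.suc-injective (trans (∣-∣-remove x∈) c)) (un , x∈G)) ,
  ¬s ∘ Pull.sunflower (_[ x ]≔ outside) (_[ x ]≔ inside) (_[ x ]≔ inside) G
         (λ X∈ → remove-add (All.lookup x∈G X∈)) (λ X Y → ∩-[]≔ X Y x)

∣X∣≡0⇒X≡⊥ : (X : Subset n) → ∣ X ∣ ≡ 0 → X ≡ ⊥
∣X∣≡0⇒X≡⊥ []            _  = refl
∣X∣≡0⇒X≡⊥ (outside ∷ X) eq = cong (outside ∷_) (∣X∣≡0⇒X≡⊥ X eq)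

erdősRado : ∀ w p (F : List (Subset n)) → SunflowerFree w (suc p) F →
            length F ≤ erdősRadoBound w p
erdősRado zero p []              _ = z≤n
erdősRado zero p (X ∷ [])        _ = s≤s z≤n
erdősRado zero p (X ∷ Y ∷ F) ((X∉ ∷ _) , (x ∷ y ∷ _) , _) =
  contradiction (trans (∣X∣≡0⇒X≡⊥ X x) (sym (∣X∣≡0⇒X≡⊥ Y y))) (All.head X∉)
erdősRado {n} (suc w) p F free@(u , un , ¬s) with ν-maximum F
... | (A , lA , A⊆F , uA , disj) , ub = begin
  length F                                  ≤⟨ cover link (union A) free hit ⟩
  length (union A) * erdősRadoBound w p     ≡⟨ cong (_* erdősRadoBound w p)
                                                 (length-union A (All.tabulate (All.lookup un ∘ A⊆F))) ⟩
  (length A * suc w) * erdősRadoBound w p   ≤⟨ ℕ.*-monoˡ-≤ (erdősRadoBound w p)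
                                                 (ℕ.*-monoˡ-≤ (suc w) A≤p) ⟩
  (p * suc w) * erdősRadoBound w p          ∎
  where
  open ℕ.≤-Reasoning
  A≤p : length A ≤ p
  A≤p = ℕ.≮⇒≥ λ p<A → ¬s
    ( take (suc p) A , trans (List.length-take (suc p) A) (ℕ.m≤n⇒m⊓n≡m p<A)
    , A⊆F ∘ take-⊆ (suc p) A , AllPairs.take⁺ (suc p) uA , ⊥ , AllPairs.take⁺ (suc p) disj )
  link : ∀ x {G : List (Subset n)} → SunflowerFree (suc w) (suc p) G →
         All (x Subset.∈_) G → length G ≤ erdősRadoBound w p
  link x {G} fr x∈ = subst (_≤ erdősRadoBound w p) (List.length-map _ G)
                       (erdősRado w p _ (link-free x fr x∈))
  hit : ∀ {X} → X ∈ F → ∃ λ x → x ∈ union A × x Subset.∈ X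
  hit {X} X∈ with All.all? (λ Y → (X ∩ Y) ≟ ⊥) A
  ... | yes X⊥A = contradiction
        (ub (suc (length A)) (X ∷ A , refl , X∷A⊆F , X∉A ∷ uA , X⊥A ∷ disj))
        (subst (λ v → ¬ (suc (length A) ≤ v)) lA (ℕ.<-irrefl refl))
    where
    X∷A⊆F : (X ∷ A) ⊆ F
    X∷A⊆F (here refl) = X∈
    X∷A⊆F (there p)   = A⊆F p
    X≢⊥ : X ≢ ⊥
    X≢⊥ refl with trans (sym (Subset.∣⊥∣≡0 n)) (All.lookup un X∈)
    ... | ()
    X∉A : All (X ≢_) A
    X∉A = All.map (λ { eq refl → X≢⊥ (trans (sym (Subset.∩-idem X)) eq) }) X⊥A
  ... | no ¬X⊥A with find (All.¬All⇒Any¬ (λ Y → (X ∩ Y) ≟ ⊥) A ¬X⊥A)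
  ... | Y , Y∈ , X∩Y≢⊥ with Subset.nonempty? (X ∩ Y)
  ... | yes (x , x∈) = x , ∈-union Y∈ (proj₂ (Subset.x∈p∩q⁻ X Y x∈)) , proj₁ (Subset.x∈p∩q⁻ X Y x∈)
  ... | no empty     = contradiction (Subset.Empty-unique empty) X∩Y≢⊥

∣insertAt∣ : (X : Subset n) → ∀ x → ∣ Vec.insertAt X x outside ∣ ≡ ∣ X ∣
∣insertAt∣ X             zero    = refl
∣insertAt∣ (inside  ∷ X) (suc x) = cong suc (∣insertAt∣ X x)
∣insertAt∣ (outside ∷ X) (suc x) = ∣insertAt∣ X x

insertAt-∩ : (X Y : Subset n) → ∀ x →
  Vec.insertAt X x outside ∩ Vec.insertAt Y x outside ≡ Vec.insertAt (X ∩ Y) x outside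
insertAt-∩ X       Y       zero    = refl
insertAt-∩ (b ∷ X) (d ∷ Y) (suc x) = cong ((b ∧ d) ∷_) (insertAt-∩ X Y x)

insertAt-⊥ : (x : Fin (suc n)) → Vec.insertAt ⊥ x outside ≡ ⊥
insertAt-⊥         zero    = refl
insertAt-⊥ {suc n} (suc x) = cong (outside ∷_) (insertAt-⊥ x)

removeAt-insertAt : ∀ {X : Subset (suc n)} {x} → x Subset.∉ X →
                    Vec.insertAt (Vec.removeAt X x) x outside ≡ X
removeAt-insertAt {X = X} {x} x∉ =
  trans (cong (Vec.insertAt (Vec.removeAt X x) x) (sym eq)) (Vec.insertAt-removeAt X x)
  where
  eq : Vec.lookup X x ≡ outside
  eq = Bool.¬-not (x∉ ∘ Vec.lookup⇒[]= x X)

unused : ∀ {w} (F : List (Subset n)) → Uniform w F → length F * w < n →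
         ∃ λ x → All (x Subset.∉_) F
unused {n} F un lt with Fin.any? (λ x → All.all? (λ X → ¬? (x Subset.∈? X)) F)
... | yes found = found
... | no  none  = contradiction n≤ (ℕ.<⇒≱ lt)
  where
  used : ∀ x → x ∈ union F
  used x with Any.any? (λ X → x Subset.∈? X) F
  ... | yes p with find p
  ... | X , X∈ , x∈ = ∈-union X∈ x∈
  used x | no ¬p = contradiction (x , All.¬Any⇒All¬ F ¬p) none
  n≤ : n ≤ length F * _
  n≤ = subst₂ _≤_ (List.length-tabulate id) (length-union F un)
         (unique-⊆⇒length≤ (Unique.allFin⁺ n) λ {x} _ → used x)

compress : ∀ {w k} n (F : List (Subset n)) → SunflowerFree w k F →
           ∃ λ n′ → n′ < suc (length F * w) × ∃ λ (F′ : List (Subset n′)) →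
             length F′ ≡ length F × SunflowerFree w k F′ ×
             (∀ {r} → ContainsMatching F′ r → ContainsMatching F r)
compress {w} n F free with ℕ.<-≤-connex (length F * w) n
... | inj₂ n≤ = n , s≤s n≤ , F , refl , free , id
compress {w} (suc n) F free@(u , un , ¬s) | inj₁ lt with unused F un lt
... | x , x∉ with compress n (map (λ X → Vec.removeAt X x) F) free′
  where
  γφ : ∀ {X} → X ∈ F → Vec.insertAt (Vec.removeAt X x) x outside ≡ X
  γφ X∈ = removeAt-insertAt (All.lookup x∉ X∈)
  free′ : SunflowerFree w _ (map (λ X → Vec.removeAt X x) F)
  free′ = unique-map (λ X → Vec.removeAt X x) (λ Y → Vec.insertAt Y x outside) F γφ u
        , All.map⁺ (All.tabulate λ {X} X∈ →
            trans (sym (∣insertAt∣ (Vec.removeAt X x) x))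
                  (trans (cong ∣_∣ (γφ X∈)) (All.lookup un X∈)))
        , ¬s ∘ Pull.sunflower (λ X → Vec.removeAt X x) (λ Y → Vec.insertAt Y x outside) (λ Y → Vec.insertAt Y x outside) F γφ
                 (λ X Y → insertAt-∩ X Y x)
... | n′ , n′< , F′ , l , fr , ms =
  n′ , subst (λ l → n′ < suc (l * w)) lφ n′< , F′ , trans l lφ , fr ,
  Pull.matching (λ X → Vec.removeAt X x) (λ Y → Vec.insertAt Y x outside) (λ Y → Vec.insertAt Y x outside) F
    (λ X∈ → removeAt-insertAt (All.lookup x∉ X∈)) (λ X Y → insertAt-∩ X Y x) (insertAt-⊥ x) ∘ ms
  where lφ = List.length-map (λ X → Vec.removeAt X x) F

IsSizeF : ℕ → ℕ → ℕ → Set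
IsSizeF w k s = ∃ λ n → ∃ λ (F : List (Subset n)) → length F ≡ s × SunflowerFree w k F

IsSizeΨ : ℕ → ℕ → ℕ → ℕ → Set
IsSizeΨ w k m s = ∃ λ n → ∃ λ (F : List (Subset n)) →
  length F ≡ s × SunflowerFree w k F × ν F ≤ m ∸ 1

isSizeF? : ∀ w k → Decidable (IsSizeF w k)
isSizeF? w k s = map′
  (λ { (n , _ , F , l , fr) → n , F , l , fr })
  (λ { (n , F , refl , fr) → let n′ , n′< , F′ , l , fr′ , _ = compress n F fr in
       n′ , n′< , F′ , l , fr′ })
  (ℕ.anyUpTo? (λ n → anyOfLength? {n} s (sunflowerFree? w k)) (suc (s * w)))

isSizeΨ? : ∀ w k m → Decidable (IsSizeΨ w k m)
isSizeΨ? w k m s = map′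
  (λ { (n , _ , F , l , fr) → n , F , l , fr })
  (λ { (n , F , refl , fr , ν≤) → let n′ , n′< , F′ , l , fr′ , ms = compress n F fr in
       n′ , n′< , F′ , l , fr′ ,
       ℕ.≤-trans (proj₂ (ν-maximum F) (ν F′) (ms (proj₁ (ν-maximum F′)))) ν≤ })
  (ℕ.anyUpTo? (λ n → anyOfLength? {n} s λ F → sunflowerFree? w k F ×-dec (ν F ℕ.≤? m ∸ 1))
     (suc (s * w)))

[]-free : ∀ w p → SunflowerFree {0} w (suc p) []
[]-free w p = [] , [] , λ { (_ ∷ _ , _ , A⊆ , _) → contradiction (A⊆ (here refl)) λ () }

abstract
  f-exists : ∀ w p → ∃ (IsMaximum (IsSizeF w (suc p)))
  f-exists w p = maximum (isSizeF? w (suc p)) (0 , [] , refl , []-free w p)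
    (erdősRadoBound w p) λ { u (n , F , refl , fr) → erdősRado w p F fr }

  ψ-exists : ∀ w p m → ∃ (IsMaximum (IsSizeΨ w (suc p) m))
  ψ-exists w p m = maximum (isSizeΨ? w (suc p) m)
    (0 , [] , refl , []-free w p ,
     ℕ.≤-trans (matching-bound [] _ (proj₁ (ν-maximum {0} []))) z≤n)
    (erdősRadoBound w p) λ { u (n , F , refl , fr , _) → erdősRado w p F fr }

-- The value at k = 0 is junk: every family contains the empty
-- 0-sunflower, so there is no maximum to take.

f : ℕ → ℕ → ℕ
f w zero    = 0
f w (suc p) = proj₁ (f-exists w p)

ψ : ℕ → ℕ → ℕ → ℕ
ψ w zero    m = 0
ψ w (suc p) m = proj₁ (ψ-exists w p m)

f-maximum : ∀ w p → IsMaximum (IsSizeF w (suc p)) (f w (suc p))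
f-maximum w p = proj₂ (f-exists w p)

ψ-maximum : ∀ w p m → IsMaximum (IsSizeΨ w (suc p) m) (ψ w (suc p) m)
ψ-maximum w p m = proj₂ (ψ-exists w p m)

{-# OPTIONS --safe #-}
module Submission where

-- Write p = k - 1 and take p fresh points. Let G realise ψ (w - 1) k m and H
-- realise f (w - t) k, on disjoint ground sets. The family consists of all
-- {x} ∪ g with x a fresh point and g ∈ G, together with all B ∪ h with h ∈ H
-- and B one of ⌊p / t⌋ disjoint blocks of t fresh points. Call the fresh part
-- of a member its trace.
--
-- A matching using some B ∪ h has disjoint nonempty traces, one of size t, so
-- its size is at most p - t + 1 = m - 1; any other matching comes from one of G.
--
-- The traces of the k = p + 1 sets of a sunflower cannot be disjoint, so its
-- core meets the fresh points. Hence two members of the same kind have equal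
-- traces, namely the trace of the core, and since t ≥ 2 the two kinds cannot
-- mix, except when a single B ∪ h meets k - 1 sets {x} ∪ g. But then the core
-- is {x}, and the k - 1 > m - 1 sets g are pairwise disjoint.

open import Defs
open import Data.Nat.Base using (ℕ; suc; _+_; _*_; _∸_; _≤_; _≥_; _/_)

open import Data.Bool.Base using (_∧_)
open import Data.Fin.Subset
  using (Subset; inside; outside; _∩_; _∪_; ∣_∣; ⊥; ⊤)
import Data.Fin.Subset.Properties as Subset
open import Data.List.Base
  using (List; []; _∷_; length; map; _++_; filter; cartesianProductWith)
import Data.List.Membership.DecPropositional as DecMembership
open import Data.List.Membership.Propositional using (_∈_; find)
import Data.List.Membership.Propositional.Properties as Mem
import Data.List.Properties as List
open import Data.List.Relation.Binary.Subset.Propositional using (_⊆_)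
open import Data.List.Relation.Unary.All as All using (All; []; _∷_)
import Data.List.Relation.Unary.All.Properties as All
open import Data.List.Relation.Unary.AllPairs as AllPairs using (AllPairs; []; _∷_)
import Data.List.Relation.Unary.AllPairs.Properties as AllPairs
open import Data.List.Relation.Unary.Any using (here; there)
open import Data.List.Relation.Unary.Unique.Propositional using (Unique)
import Data.List.Relation.Unary.Unique.Propositional.Properties as Unique
open import Data.Nat.Base using (zero; _<_; z≤n; s≤s)
import Data.Nat.DivMod as ℕ
open import Data.Nat.ListAction using (sum)
import Data.Nat.Properties as ℕ
open import Data.Product.Base using (∃; _×_; _,_; proj₁; proj₂)
open import Data.Sum.Base using (inj₁; inj₂)
open import Data.Vec.Base as Vec using (Vec; []; _∷_; take; drop)
import Data.Vec.Properties as Vec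
open import Function.Base using (_∘_)
open import Relation.Binary.Definitions using (Symmetric)
open import Relation.Binary.PropositionalEquality
open import Relation.Nullary using (¬_; yes; no; contradiction)
open import Relation.Nullary.Decidable using (¬?)

private
  variable
    a b n p t w : ℕ
    A : Set

Disjoint : List (Subset n) → Set
Disjoint = AllPairs (λ X Y → X ∩ Y ≡ ⊥)

-- Subsets of a ground set split into two segments.

take-++ : (xs : Vec A a) (ys : Vec A b) → take a (xs Vec.++ ys) ≡ xs
take-++ []       ys = refl
take-++ (x ∷ xs) ys = cong (x ∷_) (take-++ xs ys)

drop-++ : (xs : Vec A a) (ys : Vec A b) → drop a (xs Vec.++ ys) ≡ ys
drop-++ []       ys = refl
drop-++ (x ∷ xs) ys = drop-++ xs ys

take-⊥ : ∀ a → take a (⊥ {a + b}) ≡ ⊥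
take-⊥ zero    = refl
take-⊥ (suc a) = cong (outside ∷_) (take-⊥ a)

drop-⊥ : ∀ a → drop a (⊥ {a + b}) ≡ ⊥
drop-⊥ zero    = refl
drop-⊥ (suc a) = drop-⊥ a

⊥-++ : ∀ a → ⊥ {a} Vec.++ ⊥ {b} ≡ ⊥
⊥-++ zero    = refl
⊥-++ (suc a) = cong (outside ∷_) (⊥-++ a)

++-∩-++ : (X Y : Subset a) (X′ Y′ : Subset b) →
          (X Vec.++ X′) ∩ (Y Vec.++ Y′) ≡ (X ∩ Y) Vec.++ (X′ ∩ Y′)
++-∩-++ X Y X′ Y′ = Vec.zipWith-++ _∧_ X X′ Y Y′

∣++∣ : (X : Subset a) (Y : Subset b) → ∣ X Vec.++ Y ∣ ≡ ∣ X ∣ + ∣ Y ∣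
∣++∣ []            Y = refl
∣++∣ (inside  ∷ X) Y = cong suc (∣++∣ X Y)
∣++∣ (outside ∷ X) Y = ∣++∣ X Y

-- Sizes of pairwise disjoint sets.

∣∪∣-disjoint : (X Y : Subset n) → X ∩ Y ≡ ⊥ → ∣ X ∪ Y ∣ ≡ ∣ X ∣ + ∣ Y ∣
∣∪∣-disjoint []            []            _  = refl
∣∪∣-disjoint (outside ∷ X) (outside ∷ Y) eq = ∣∪∣-disjoint X Y (Vec.∷-injectiveʳ eq)
∣∪∣-disjoint (inside  ∷ X) (outside ∷ Y) eq = cong suc (∣∪∣-disjoint X Y (Vec.∷-injectiveʳ eq))
∣∪∣-disjoint (outside ∷ X) (inside  ∷ Y) eq =
  trans (cong suc (∣∪∣-disjoint X Y (Vec.∷-injectiveʳ eq))) (sym (ℕ.+-suc _ _))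

-- `Z` accumulates the union of the sets already passed, so the induction only has to compare each
-- remaining set with one set.
sum-sizes+≤ : (Z : Subset n) (L : List (Subset n)) → All (λ X → X ∩ Z ≡ ⊥) L →
              Disjoint L → sum (map ∣_∣ L) + ∣ Z ∣ ≤ n
sum-sizes+≤         Z []      []        []        = Subset.∣p∣≤n Z
sum-sizes+≤ {n = n} Z (X ∷ L) (XZ ∷ LZ) (XL ∷ LL) = begin
  (∣ X ∣ + sum (map ∣_∣ L)) + ∣ Z ∣   ≡⟨ cong (_+ ∣ Z ∣) (ℕ.+-comm ∣ X ∣ _) ⟩
  (sum (map ∣_∣ L) + ∣ X ∣) + ∣ Z ∣   ≡⟨ ℕ.+-assoc _ ∣ X ∣ ∣ Z ∣ ⟩
  sum (map ∣_∣ L) + (∣ X ∣ + ∣ Z ∣)   ≡⟨ cong (sum (map ∣_∣ L) +_) (∣∪∣-disjoint X Z XZ) ⟨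
  sum (map ∣_∣ L) + ∣ X ∪ Z ∣         ≤⟨ sum-sizes+≤ (X ∪ Z) L (All.zipWith avoids (XL , LZ)) LL ⟩
  n                                   ∎
  where
  open ℕ.≤-Reasoning
  avoids : ∀ {Y} → X ∩ Y ≡ ⊥ × Y ∩ Z ≡ ⊥ → Y ∩ (X ∪ Z) ≡ ⊥
  avoids {Y} (XY , YZ) = trans (Subset.∩-distribˡ-∪ Y X Z)
    (trans (cong₂ _∪_ (trans (Subset.∩-comm Y X) XY) YZ) (Subset.∪-identityˡ ⊥))

disjoint⇒sum-sizes≤ : (L : List (Subset n)) → Disjoint L → sum (map ∣_∣ L) ≤ n
disjoint⇒sum-sizes≤ {n = n} L dis = ℕ.≤-trans (ℕ.m≤m+n _ ∣ ⊥ {n = n} ∣)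
  (sum-sizes+≤ (⊥ {n}) L (All.tabulate λ {X} _ → Subset.∩-zeroʳ X) dis)

length≤sum-sizes : (L : List (Subset n)) → All (λ X → 1 ≤ ∣ X ∣) L → length L ≤ sum (map ∣_∣ L)
length≤sum-sizes []      []        = z≤n
length≤sum-sizes (X ∷ L) (1≤ ∷ ne) = ℕ.+-mono-≤ 1≤ (length≤sum-sizes L ne)

-- Every set contributes at least 1 to the sum and `Y` contributes its full size; the `suc` pays for
-- counting `Y` in the length as well. This bounds a matching that uses a block.
length+size≤sum-sizes : ∀ {Y} (L : List (Subset n)) → All (λ X → 1 ≤ ∣ X ∣) L → Y ∈ L →
                        length L + ∣ Y ∣ ≤ suc (sum (map ∣_∣ L))
length+size≤sum-sizes (X ∷ L) (_ ∷ ne) (here refl) =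
  s≤s (subst (_≤ ∣ X ∣ + sum (map ∣_∣ L)) (ℕ.+-comm ∣ X ∣ (length L)) (ℕ.+-monoʳ-≤ ∣ X ∣ (length≤sum-sizes L ne)))
length+size≤sum-sizes {Y = Y} (X ∷ L) (1≤ ∷ ne) (there Y∈) =
  subst (suc (length L) + ∣ Y ∣ ≤_) (ℕ.+-suc ∣ X ∣ _) (ℕ.+-mono-≤ 1≤ (length+size≤sum-sizes L ne Y∈))

disjoint⇒unique : (L : List (Subset n)) → All (λ X → 1 ≤ ∣ X ∣) L → Disjoint L → Unique L
disjoint⇒unique         []      []        []          = []
disjoint⇒unique {n = n} (X ∷ L) (1≤ ∷ ne) (XL ∷ dis) =
  All.map distinct XL ∷ disjoint⇒unique L ne dis
  where
  distinct : ∀ {Y} → X ∩ Y ≡ ⊥ → X ≢ Y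
  distinct X∩X≡⊥ refl = ℕ.<⇒≢ 1≤
    (sym (trans (cong ∣_∣ (trans (sym (Subset.∩-idem X)) X∩X≡⊥)) (Subset.∣⊥∣≡0 n)))

-- The first `t` points form one block and the recursion runs on the `o` points left. With `t = 1`
-- this also yields the singletons of fresh points.
blocks : ∀ q t → q * t ≤ n →
         ∃ λ (Bs : List (Subset n)) → length Bs ≡ q × Uniform t Bs × Disjoint Bs
blocks zero    t _  = [] , refl , [] , []
blocks (suc q) t le with ℕ.m≤n⇒∃[o]m+o≡n (ℕ.≤-trans (ℕ.m≤m+n t (q * t)) le)
... | o , refl with blocks {n = o} q t (ℕ.+-cancelˡ-≤ t _ _ le)
... | Bs , refl , un , dis =
  (⊤ {t} Vec.++ ⊥ {o}) ∷ map (⊥ {t} Vec.++_) Bs ,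
  cong suc (List.length-map _ Bs) ,
  trans (∣++∣ (⊤ {t}) (⊥ {o})) (trans (cong₂ _+_ (Subset.∣⊤∣≡n t) (Subset.∣⊥∣≡0 o)) (ℕ.+-identityʳ t))
    ∷ All.map⁺ (All.map (λ {B} ∣B∣ → trans (∣++∣ (⊥ {t}) B) (cong₂ _+_ (Subset.∣⊥∣≡0 t) ∣B∣)) un) ,
  All.map⁺ (All.tabulate λ {B} _ → trans (++-∩-++ ⊤ ⊥ ⊥ B)
      (trans (cong₂ Vec._++_ (Subset.∩-zeroʳ ⊤) (Subset.∩-zeroˡ B)) (⊥-++ t)))
    ∷ AllPairs.map⁺ (AllPairs.map (λ {X} {Y} XY → trans (++-∩-++ ⊥ ⊥ X Y)
        (trans (cong₂ Vec._++_ (Subset.∩-idem ⊥) XY) (⊥-++ t))) dis)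

-- Picking members from a list.

-- `AllPairs` relates members in list order only; symmetry frees the relation from that order.
allPairs-lookup : {R : A → A → Set} → Symmetric R → ∀ {x y xs} → AllPairs R xs →
                  x ∈ xs → y ∈ xs → x ≢ y → R x y
allPairs-lookup sy (xR ∷ _) (here refl) (here refl) x≢y = contradiction refl x≢y
allPairs-lookup sy (xR ∷ _) (here refl) (there y∈)  x≢y = All.lookup xR y∈
allPairs-lookup sy (yR ∷ _) (there x∈)  (here refl) x≢y = sy (All.lookup yR x∈)
allPairs-lookup sy (_ ∷ ap) (there x∈)  (there y∈)  x≢y = allPairs-lookup sy ap x∈ y∈ x≢y

another : ∀ {x} {xs : List A} → Unique xs → 2 ≤ length xs → x ∈ xs → ∃ λ y → y ∈ xs × x ≢ y
another {xs = x ∷ []}    _               (s≤s ()) _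
another {xs = x ∷ y ∷ _} ((x≢y ∷ _) ∷ _) _ (here refl) = y , there (here refl) , x≢y
another {xs = y ∷ _}     (y∉ ∷ _)        _ (there x∈)  = y , here refl , All.lookup y∉ x∈ ∘ sym

element : (xs : List A) → 1 ≤ length xs → ∃ (_∈ xs)
element (x ∷ _) _ = x , here refl

-- Products of a family of traces with a family of remainders.

_⊗_ : List (Subset a) → List (Subset b) → List (Subset (a + b))
_⊗_ = cartesianProductWith Vec._++_

∈-⊗⁻ : (Ts : List (Subset a)) (Gs : List (Subset b)) → ∀ {X} → X ∈ Ts ⊗ Gs →
       take a X ∈ Ts × drop a X ∈ Gs
∈-⊗⁻ Ts Gs X∈ with Mem.∈-cartesianProductWith⁻ Vec._++_ Ts Gs X∈
... | T , G , T∈ , G∈ , refl =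
  subst (_∈ Ts) (sym (take-++ T G)) T∈ , subst (_∈ Gs) (sym (drop-++ T G)) G∈

length-⊗ : (Ts : List (Subset a)) (Gs : List (Subset b)) →
           length (Ts ⊗ Gs) ≡ length Ts * length Gs
length-⊗ []       Gs = refl
length-⊗ (T ∷ Ts) Gs = trans (List.length-++ (map (T Vec.++_) Gs))
  (cong₂ _+_ (List.length-map (T Vec.++_) Gs) (length-⊗ Ts Gs))

unique-⊗ : {Ts : List (Subset a)} {Gs : List (Subset b)} → Unique Ts → Unique Gs →
           Unique (Ts ⊗ Gs)
unique-⊗ = Unique.cartesianProductWith⁺ Vec._++_ (Vec.++-injective _ _)

∣take∣+∣drop∣ : ∀ a (X : Subset (a + b)) → ∣ take a X ∣ + ∣ drop a X ∣ ≡ ∣ X ∣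
∣take∣+∣drop∣ a X =
  trans (sym (∣++∣ (take a X) (drop a X))) (cong ∣_∣ (Vec.take++drop≡id a X))

uniform-⊗ : ∀ {Ts : List (Subset a)} {Gs : List (Subset b)} → Uniform t Ts → Uniform w Gs →
            Uniform (t + w) (Ts ⊗ Gs)
uniform-⊗ {a = a} {Ts = Ts} {Gs} uT uG = All.tabulate λ {X} X∈ →
  let T∈ , G∈ = ∈-⊗⁻ Ts Gs X∈ in
  trans (sym (∣take∣+∣drop∣ a X)) (cong₂ _+_ (All.lookup uT T∈) (All.lookup uG G∈))

take-∩ : ∀ a (X Y : Subset (a + b)) → take a (X ∩ Y) ≡ take a X ∩ take a Y
take-∩ a X Y = Vec.take-zipWith _∧_ X Y

drop-∩ : ∀ a (X Y : Subset (a + b)) → drop a (X ∩ Y) ≡ drop a X ∩ drop a Y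
drop-∩ a X Y = Vec.drop-zipWith {m = a} _∧_ X Y

-- Sunflowers whose core meets the fresh points.

module _ {Ts : List (Subset a)} {Gs : List (Subset b)} (dis : Disjoint Ts)
         {L C} (L⊆ : L ⊆ Ts ⊗ Gs) (u : Unique L) (sun : AllPairs (λ X Y → X ∩ Y ≡ C) L)
         (core : take a C ≢ ⊥) (2≤ : 2 ≤ length L) where

  -- The traces of `X` and any other petal meet in the nonempty trace of the core. Members of `Ts`
  -- that meet are equal, so this intersection is the trace of `X` itself.
  trace≡core : ∀ {X} → X ∈ L → take a X ≡ take a C
  trace≡core {X} X∈ with another u 2≤ X∈
  ... | Y , Y∈ , X≢Y with take a X ≟ take a Y
  ... | yes eq = trans (sym (Subset.∩-idem _)) (trans (cong (take a X ∩_) eq) meet)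
    where
    meet : take a X ∩ take a Y ≡ take a C
    meet = trans (sym (take-∩ a X Y))
      (cong (take a) (allPairs-lookup (trans (Subset.∩-comm _ _)) sun X∈ Y∈ X≢Y))
  ... | no ¬eq = contradiction
    (trans (cong (take a) (sym (allPairs-lookup (trans (Subset.∩-comm _ _)) sun X∈ Y∈ X≢Y)))
      (trans (take-∩ a X Y)
        (allPairs-lookup (trans (Subset.∩-comm _ _)) dis
          (proj₁ (∈-⊗⁻ Ts Gs (L⊆ X∈))) (proj₁ (∈-⊗⁻ Ts Gs (L⊆ Y∈))) ¬eq)))
    core

  private
    module Fibre = Pull (take a C Vec.++_) (drop a) (drop a) Gs
                        (λ {X} _ → drop-++ (take a C) X) (λ X Y → sym (drop-∩ a X Y))

    -- All petals share one trace, so `L` lies in a copy of `Gs` and `drop a` loses nothing on it.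
    L⊆fibre : L ⊆ map (take a C Vec.++_) Gs
    L⊆fibre {X} X∈ = subst (_∈ map (take a C Vec.++_) Gs)
      (trans (cong (Vec._++ drop a X) (sym (trace≡core X∈))) (Vec.take++drop≡id a X))
      (Mem.∈-map⁺ (take a C Vec.++_) (proj₂ (∈-⊗⁻ Ts Gs (L⊆ X∈))))

  fibre-sunflower : ContainsSunflower (length L) Gs
  fibre-sunflower = Fibre.sunflower (L , refl , L⊆fibre , u , C , sun)

  -- If the core lies within the fresh points, the remainders of the petals are pairwise disjoint.
  fibre-matching : drop a C ≡ ⊥ → ContainsMatching Gs (length L)
  fibre-matching C⊥ with Fibre.pull L⊆fibre u
  ... | s , u′ = map (drop a) L , List.length-map (drop a) L , s , u′ ,
                 AllPairs.map (λ eq → trans eq C⊥) (Fibre.pull-∩ sun)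

trace-disjoint : ∀ a {L : List (Subset (a + b))} {C} → AllPairs (λ X Y → X ∩ Y ≡ C) L →
                 take a C ≡ ⊥ → Disjoint (map (take a) L)
trace-disjoint a sun C⊥ = AllPairs.map⁺ (AllPairs.map
  (λ {X} {Y} eq → trans (sym (take-∩ a X Y)) (trans (cong (take a) eq) C⊥)) sun)

-- The combined family.

module Construction
  {Ts Bs : List (Subset p)} {Gs Hs : List (Subset n)} {w w′ r t}
  -- Here `r` stands for m - 1, and `r + t ≡ suc p` says t = k - m + 1 without subtraction. `Gs` and
  -- `Hs` share one type of subsets; `G∩H` records that their members are disjoint.
  (disT : Disjoint Ts) (uT : Uniform 1 Ts) (disB : Disjoint Bs) (uB : Uniform t Bs)
  (freeG : SunflowerFree w (suc p) Gs) (freeH : SunflowerFree w′ (suc p) Hs)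
  (matchG : ∀ {s} → ContainsMatching Gs s → s ≤ r)
  (G∩H : ∀ {X Y} → X ∈ Gs → Y ∈ Hs → X ∩ Y ≡ ⊥)
  (1≤w : 1 ≤ w) (2≤p : 2 ≤ p) (2≤t : 2 ≤ t) (r+t : r + t ≡ suc p) (t+w′ : t + w′ ≡ suc w)
  where

  family : List (Subset (p + n))
  family = (Ts ⊗ Gs) ++ (Bs ⊗ Hs)

  open DecMembership (_≟_ {p + n}) using (_∈?_)

  traceT : ∀ {X} → X ∈ Ts ⊗ Gs → ∣ take p X ∣ ≡ 1
  traceT X∈ = All.lookup uT (proj₁ (∈-⊗⁻ Ts Gs X∈))

  traceB : ∀ {X} → X ∈ Bs ⊗ Hs → ∣ take p X ∣ ≡ t
  traceB X∈ = All.lookup uB (proj₁ (∈-⊗⁻ Bs Hs X∈))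

  1≤trace : ∀ {X} → X ∈ family → 1 ≤ ∣ take p X ∣
  1≤trace X∈ with Mem.∈-++⁻ (Ts ⊗ Gs) X∈
  ... | inj₁ X∈T = ℕ.≤-reflexive (sym (traceT X∈T))
  ... | inj₂ X∈B = subst (1 ≤_) (sym (traceB X∈B)) (ℕ.<⇒≤ 2≤t)

  1≤traces : ∀ {L} → L ⊆ family → All (λ X → 1 ≤ ∣ X ∣) (map (take p) L)
  1≤traces L⊆ = All.map⁺ (All.tabulate (1≤trace ∘ L⊆))

  r<p : r < p
  r<p = ℕ.+-cancelʳ-< 1 _ _ (subst (r + 1 <_) (trans r+t (ℕ.+-comm 1 p)) (ℕ.+-monoʳ-< r 2≤t))

  unique : Unique family
  unique = Unique.++⁺
    (unique-⊗ (disjoint⇒unique Ts (All.map (ℕ.≤-reflexive ∘ sym) uT) disT) (proj₁ freeG))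
    (unique-⊗ (disjoint⇒unique Bs
                 (All.map (λ eq → subst (1 ≤_) (sym eq) (ℕ.<⇒≤ 2≤t)) uB) disB) (proj₁ freeH))
    λ { (X∈T , X∈B) → ℕ.<⇒≢ 2≤t (trans (sym (traceT X∈T)) (traceB X∈B)) }

  uniform : Uniform (suc w) family
  uniform = All.++⁺ (uniform-⊗ uT (proj₁ (proj₂ freeG)))
    (subst (λ v → Uniform v (Bs ⊗ Hs)) t+w′ (uniform-⊗ uB (proj₁ (proj₂ freeH))))

  matching : ∀ {s} → ContainsMatching family s → s ≤ r
  matching (L , refl , L⊆ , u , dis) with All.all? (_∈? (Ts ⊗ Gs)) L
  ... | yes L⊆T = matchG
      ( map (drop p) L , List.length-map (drop p) L
      , (λ Y∈ → let X , X∈ , eq = Mem.∈-map⁻ (drop p) Y∈ in subst (_∈ Gs) (sym eq) (inG X∈))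
      -- Dropping traces could merge members, but the remainders are disjoint and, as `1 ≤ w`,
      -- nonempty.
      , disjoint⇒unique _ (All.map⁺ (All.tabulate λ X∈ →
          subst (1 ≤_) (sym (All.lookup (proj₁ (proj₂ freeG)) (inG X∈))) 1≤w)) dis′
      , dis′ )
    where
    inG : ∀ {X} → X ∈ L → drop p X ∈ Gs
    inG X∈ = proj₂ (∈-⊗⁻ Ts Gs (All.lookup L⊆T X∈))
    dis′ : Disjoint (map (drop p) L)
    dis′ = AllPairs.map⁺ (AllPairs.map (λ {X} {Y} eq →
      trans (sym (drop-∩ p X Y)) (trans (cong (drop p) eq) (drop-⊥ p))) dis)
  ... | no ¬L⊆T with find (All.¬All⇒Any¬ (_∈? (Ts ⊗ Gs)) L ¬L⊆T)
  ... | Y , Y∈L , Y∉T with Mem.∈-++⁻ (Ts ⊗ Gs) (L⊆ Y∈L)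
  ... | inj₁ Y∈T = contradiction Y∈T Y∉T
  -- The trace of `Y` occupies `t` of the `p` fresh points and every other member at least one more.
  ... | inj₂ Y∈B = ℕ.+-cancelʳ-≤ t _ _ (begin
    length L + t                                       ≡⟨ cong₂ _+_ (List.length-map (take p) L) (traceB Y∈B) ⟨
    length (map (take p) L) + ∣ take p Y ∣             ≤⟨ length+size≤sum-sizes _ (1≤traces L⊆) (Mem.∈-map⁺ (take p) Y∈L) ⟩
    suc (sum (map ∣_∣ (map (take p) L)))               ≤⟨ s≤s (disjoint⇒sum-sizes≤ _ (trace-disjoint p dis (take-⊥ p))) ⟩
    suc p                                              ≡⟨ r+t ⟨
    r + t                                              ∎)
    where open ℕ.≤-Reasoning

  sunflower-free : ¬ ContainsSunflower (suc p) family
  sunflower-free (L , lL , L⊆ , u , C , sun) =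
    cases _ _ refl refl (trans (sym lL) (length-split inT? L))
    where
    inT? = _∈? (Ts ⊗ Gs)
    L₁ = filter inT? L
    L₂ = filter (¬? ∘ inT?) L

    -- Otherwise `p + 1` disjoint nonempty traces would fit into `p` points.
    core : take p C ≢ ⊥
    core C⊥ = ℕ.<-irrefl refl
      (subst (_≤ p) (trans (List.length-map (take p) L) lL) (ℕ.≤-trans (length≤sum-sizes _ (1≤traces L⊆))
                      (disjoint⇒sum-sizes≤ _ (trace-disjoint p sun C⊥))))

    L₁⊆ : L₁ ⊆ Ts ⊗ Gs
    L₁⊆ = All.lookup (All.all-filter inT? L)

    L₂⊆ : L₂ ⊆ Bs ⊗ Hs
    L₂⊆ X∈ with Mem.∈-filter⁻ (¬? ∘ inT?) X∈
    ... | X∈L , X∉T with Mem.∈-++⁻ (Ts ⊗ Gs) (L⊆ X∈L)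
    ... | inj₁ X∈T = contradiction X∈T X∉T
    ... | inj₂ X∈B = X∈B

    u₁ = Unique.filter⁺ inT? u
    u₂ = Unique.filter⁺ (¬? ∘ inT?) u
    sun₁ = AllPairs.filter⁺ inT? sun
    sun₂ = AllPairs.filter⁺ (¬? ∘ inT?) sun

    X∩Y≡C : ∀ {X Y} → X ∈ L₁ → Y ∈ L₂ → X ∩ Y ≡ C
    X∩Y≡C X∈ Y∈ with Mem.∈-filter⁻ inT? X∈ | Mem.∈-filter⁻ (¬? ∘ inT?) Y∈
    ... | X∈L , X∈T | Y∈L , Y∉T =
      allPairs-lookup (trans (Subset.∩-comm _ _)) sun X∈L Y∈L λ { refl → Y∉T X∈T }

    cases : ∀ a b → length L₁ ≡ a → length L₂ ≡ b → suc p ≢ a + b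
    -- All petals are of the first kind, so their remainders form a sunflower in `Gs`; the next
    -- clause does the same with `Hs`.
    cases a 0 l₁ l₂ eq = proj₂ (proj₂ freeG) (subst (λ s → ContainsSunflower s Gs)
      (trans l₁ (sym k≡a))
      (fibre-sunflower disT L₁⊆ u₁ sun₁ core
        (subst (2 ≤_) (trans k≡a (sym l₁)) (ℕ.m≤n⇒m≤1+n 2≤p))))
      where k≡a = trans eq (ℕ.+-identityʳ a)
    cases 0 b@(suc _) l₁ l₂ eq = proj₂ (proj₂ freeH) (subst (λ s → ContainsSunflower s Hs)
      (trans l₂ (sym eq))
      (fibre-sunflower disB L₂⊆ u₂ sun₂ core
        (subst (2 ≤_) (trans eq (sym l₂)) (ℕ.m≤n⇒m≤1+n 2≤p))))
    cases (suc a) (suc b) l₁ l₂ eq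
      with element L₁ (subst (1 ≤_) (sym l₁) (s≤s z≤n)) | element L₂ (subst (1 ≤_) (sym l₂) (s≤s z≤n))
    -- The core is `X ∩ Y`, whose remainder is empty by `G∩H`, so the `p` petals of the first kind
    -- give a matching in `Gs` larger than `r`.
    cases (suc a) 1 l₁ l₂ eq | X , X∈ | Y , Y∈ = ℕ.<⇒≱ r<p
      (subst (_≤ r) (trans l₁ (sym p≡a))
        (matchG (fibre-matching disT L₁⊆ u₁ sun₁ core
          (subst (2 ≤_) (trans p≡a (sym l₁)) 2≤p)
          (trans (cong (drop p) (sym (X∩Y≡C X∈ Y∈))) (trans (drop-∩ p X Y)
            (G∩H (proj₂ (∈-⊗⁻ Ts Gs (L₁⊆ X∈))) (proj₂ (∈-⊗⁻ Bs Hs (L₂⊆ Y∈)))))))))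
      where p≡a = ℕ.suc-injective (trans eq (ℕ.+-comm (suc a) 1))
    -- Two petals of the second kind force the trace of `Y` to be that of the core, which lies in
    -- the one-point trace of `X`.
    cases (suc a) (suc (suc b)) l₁ l₂ eq | X , X∈ | Y , Y∈ = ℕ.<⇒≱ 2≤t (begin
      t                             ≡⟨ traceB (L₂⊆ Y∈) ⟨
      ∣ take p Y ∣                  ≡⟨ cong ∣_∣ (trace≡core disB L₂⊆ u₂ sun₂ core
                                        (subst (2 ≤_) (sym l₂) (s≤s (s≤s z≤n))) Y∈) ⟩
      ∣ take p C ∣                  ≡⟨ cong (∣_∣ ∘ take p) (X∩Y≡C X∈ Y∈) ⟨
      ∣ take p (X ∩ Y) ∣            ≡⟨ cong ∣_∣ (take-∩ p X Y) ⟩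
      ∣ take p X ∩ take p Y ∣       ≤⟨ Subset.∣p∩q∣≤∣p∣ (take p X) (take p Y) ⟩
      ∣ take p X ∣                  ≡⟨ traceT (L₁⊆ X∈) ⟩
      1                             ∎)
      where open ℕ.≤-Reasoning

-- Padding to disjoint ground sets, and the bound.

module Padʳ {a} b (F : List (Subset a)) =
  Pull {n = a + b} (Vec._++ ⊥) (take a) (take a) F
       (λ {X} _ → take-++ X ⊥) (λ X Y → sym (take-∩ a X Y))

module Padˡ {a} b (F : List (Subset a)) =
  Pull {n = b + a} (⊥ {b} Vec.++_) (drop b) (drop b) F
       (λ {X} _ → drop-++ (⊥ {b}) X) (λ X Y → sym (drop-∩ b X Y))

padʳ-free : ∀ {k} b {F : List (Subset a)} → SunflowerFree w k F →
            SunflowerFree w k (map (Vec._++ ⊥ {b}) F)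
padʳ-free {a = a} b {F} (u , un , ¬s) =
  unique-map (Vec._++ ⊥) (take a) F (λ {X} _ → take-++ X ⊥) u ,
  All.map⁺ (All.map (λ {X} eq → trans (∣++∣ X ⊥)
    (trans (cong₂ _+_ eq (Subset.∣⊥∣≡0 b)) (ℕ.+-identityʳ _))) un) ,
  ¬s ∘ Padʳ.sunflower b F

padˡ-free : ∀ {k} b {F : List (Subset a)} → SunflowerFree w k F →
            SunflowerFree w k (map (⊥ {b} Vec.++_) F)
padˡ-free b {F} (u , un , ¬s) =
  unique-map (⊥ Vec.++_) (drop b) F (λ {X} _ → drop-++ (⊥ {b}) X) u ,
  All.map⁺ (All.map (λ {X} eq → trans (∣++∣ (⊥ {b}) X) (cong₂ _+_ (Subset.∣⊥∣≡0 b) eq)) un) ,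
  ¬s ∘ Padˡ.sunflower b F

++⊥-∩-⊥++ : {X : Subset (a + b)} {F : List (Subset a)} {H : List (Subset b)} → ∀ {Y} →
             X ∈ map (Vec._++ ⊥) F → Y ∈ map (⊥ Vec.++_) H → X ∩ Y ≡ ⊥
++⊥-∩-⊥++ {a = a} X∈ Y∈ with Mem.∈-map⁻ (Vec._++ ⊥) X∈ | Mem.∈-map⁻ (⊥ Vec.++_) Y∈
... | X , _ , refl | Y , _ , refl = trans (++-∩-++ X ⊥ ⊥ Y)
  (trans (cong₂ Vec._++_ (Subset.∩-zeroʳ X) (Subset.∩-zeroˡ Y)) (⊥-++ a))

-- Any number `q` of disjoint blocks that fits into `p` points will do; keeping `q` and `w′` as
-- variables avoids division and most truncated subtraction.
ψ-lower-bound : ∀ p m q {t w w′} → 1 ≤ w → 2 ≤ p → 2 ≤ t → q * t ≤ p →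
                m ∸ 1 + t ≡ suc p → t + w′ ≡ suc w →
                p * ψ w (suc p) m + q * f w′ (suc p) ≤ ψ (suc w) (suc p) m
ψ-lower-bound p m q {t} {w} {w′} 1≤w 2≤p 2≤t qt≤p r+t t+w′
  with ψ-maximum w p m | f-maximum w′ p
     | blocks p 1 (ℕ.≤-reflexive (ℕ.*-identityʳ p)) | blocks q t qt≤p
... | (a , G , lG , freeG , νG) , _ | (b , H , lH , freeH) , _
    | Ts , lT , uT , disT | Bs , lB , uB , disB =
  proj₂ (ψ-maximum (suc w) p m) _
    ( _ , family , size , (unique , uniform , sunflower-free)
    , matching (proj₁ (ν-maximum family)) )
  where
  G′ = map (Vec._++ ⊥ {b}) G
  H′ = map (⊥ {a} Vec.++_) H
  open Construction {Ts = Ts} {Bs = Bs} {Gs = G′} {Hs = H′} {r = m ∸ 1}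
    disT uT disB uB (padʳ-free b freeG) (padˡ-free a freeH)
    -- A matching in the padded family pulls back to one in `G`, whose matching number is at most
    -- `m ∸ 1`.
    (λ c → ℕ.≤-trans (proj₂ (ν-maximum G) _ (Padʳ.matching b G (take-⊥ a) c)) νG)
    ++⊥-∩-⊥++ 1≤w 2≤p 2≤t r+t t+w′
  size : length family ≡ p * ψ w (suc p) m + q * f w′ (suc p)
  size = trans (List.length-++ (Ts ⊗ G′)) (cong₂ _+_
    (trans (length-⊗ Ts G′) (cong₂ _*_ lT (trans (List.length-map _ G) lG)))
    (trans (length-⊗ Bs H′) (cong₂ _*_ lB (trans (List.length-map _ H) lH))))

theorem3p1 : (k m : ℕ) → k ≥ 3 → 2 ≤ m → m ≤ k ∸ 1 →
    let t = suc (k ∸ m) in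
    (w : ℕ) → w ≥ t + 1 →
    ψ w k m ≥ (k ∸ 1) * ψ (w ∸ 1) k m + ((k ∸ 1) / t) * f (w ∸ t) k
theorem3p1 (suc p) (suc m) (s≤s 2≤p) 2≤m m<p (suc w) (s≤s t≤w) =
  -- The block size t is `suc (p ∸ m)`, and ⌊(k - 1) / t⌋ blocks of it fit. That t is at least 2
  -- comes from m ≤ k - 1.
  ψ-lower-bound p (suc m) (p / suc (p ∸ m))
    (ℕ.≤-trans (ℕ.m≤n+m 1 _) t≤w) 2≤p (s≤s (ℕ.m<n⇒0<n∸m m<p))
    (ℕ.m/n*n≤m p (suc (p ∸ m)))
    (trans (ℕ.+-suc m (p ∸ m)) (cong suc (ℕ.m+[n∸m]≡n (ℕ.<⇒≤ m<p))))
    (cong suc (ℕ.m+[n∸m]≡n (ℕ.≤-trans (ℕ.m≤m+n _ 1) t≤w)))
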